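{- Let $n\ge 3$. The expectation of the number of separators in a permutation chosen uniformly at random from $S_n$ is $$\frac{4(n^3-6n^2+14n-13)}{n(n-1)(n-2)}.$$ Consequently, this expectation tends to $4$ as $n\to\infty$.
   Context: Permutations $\pi\in S_n$ are written in one-line notation $\pi=[\pi_1,\dots,\pi_n]$. The digit $\pi_i$ is a vertical separator of $\pi$ if $1<i<n$ and $|\pi_{i-1}-\pi_{i+1}|=1$. The digit $\pi_i=a$ is a horizontal separator of $\pi$ if $1<a<n$ and the values $a-1$ and $a+1$ occupy adjacent positions in $\pi$, i.e. $|\pi^{ -1}(a-1)-\pi^{ -1}(a+1)|=1$. A digit is a separator of $\pi$ if it is a vertical separator or a horizontal separator (or both); a digit that is of both types is counted once in the number of separators. -}

module Defs where

open import Data.Fin.Base using (Fin; zero; suc; toℕ; punchIn)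
open import Data.Fin.Permutation
  using (Permutation′; _≈_; _⟨$⟩ʳ_; _⟨$⟩ˡ_; id; insert; remove; insert-remove; insert-punchIn)
open import Data.Fin.Properties using (any?; punchIn-injective)
open import Data.Integer.Base using (+_)
open import Data.List.Base using (List; []; _∷_; allFin; cartesianProductWith; filter; length; map)
open import Data.List.Membership.Propositional.Properties using (∈-allFin)
open import Data.List.Properties using (length-++; length-map; length-tabulate)
import Data.List.Membership.Setoid as Membership
import Data.List.Relation.Unary.Any as Any
import Data.List.Relation.Unary.Any.Properties as Any
import Data.List.Relation.Unary.All as All
import Data.List.Relation.Unary.AllPairs as AllPairs
import Data.List.Relation.Unary.Unique.Propositional.Properties as Unique≡
import Data.List.Relation.Unary.Unique.Setoid as Unique
import Data.List.Relation.Unary.Unique.Setoid.Properties as Unique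
open import Data.Nat.Base using (ℕ; zero; suc; _+_; _*_; _∸_; _≤_; _!; ∣_-_∣; NonZero; s≤s)
open import Data.Nat.ListAction using (sum)
open import Data.Nat.Properties using (_≟_; _!≢0)
open import Data.Product.Base using (_×_; _,_; ∃-syntax)
open import Data.Rational.Base as ℚ using (ℚ; 0ℚ)
open import Data.Sum.Base using (_⊎_)
open import Level using (0ℓ)
open import Relation.Binary.Bundles using (Setoid)
open import Relation.Binary.PropositionalEquality
  using (_≡_; refl; sym; trans; cong; cong₂; setoid)
open import Relation.Nullary.Decidable using (_×-dec_; _⊎-dec_)
open import Relation.Unary using (Decidable)

-- Positions and values are numbered from 0 rather than from 1.  Since j and k
-- range over Fin n, asking for a predecessor j and a successor k of i is the
-- condition 1 < i < n of the 1-based convention.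

VerticalSeparator : ∀ {n} → Permutation′ n → Fin n → Set
VerticalSeparator {n} π i = ∃[ j ] ∃[ k ]
  suc (toℕ j) ≡ toℕ i × toℕ k ≡ suc (toℕ i) ×
  ∣ toℕ (π ⟨$⟩ʳ j) - toℕ (π ⟨$⟩ʳ k) ∣ ≡ 1

-- Here the second argument is the digit itself (a value, not a position).

HorizontalSeparator : ∀ {n} → Permutation′ n → Fin n → Set
HorizontalSeparator {n} π a = ∃[ b ] ∃[ c ]
  suc (toℕ b) ≡ toℕ a × toℕ c ≡ suc (toℕ a) ×
  ∣ toℕ (π ⟨$⟩ˡ b) - toℕ (π ⟨$⟩ˡ c) ∣ ≡ 1

-- The digit at position i is a separator.

Separator : ∀ {n} → Permutation′ n → Fin n → Set
Separator π i = VerticalSeparator π i ⊎ HorizontalSeparator π (π ⟨$⟩ʳ i)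

verticalSeparator? : ∀ {n} (π : Permutation′ n) → Decidable (VerticalSeparator π)
verticalSeparator? π i = any? λ j → any? λ k →
  (suc (toℕ j) ≟ toℕ i) ×-dec (toℕ k ≟ suc (toℕ i)) ×-dec
  (∣ toℕ (π ⟨$⟩ʳ j) - toℕ (π ⟨$⟩ʳ k) ∣ ≟ 1)

horizontalSeparator? : ∀ {n} (π : Permutation′ n) → Decidable (HorizontalSeparator π)
horizontalSeparator? π a = any? λ b → any? λ c →
  (suc (toℕ b) ≟ toℕ a) ×-dec (toℕ c ≟ suc (toℕ a)) ×-dec
  (∣ toℕ (π ⟨$⟩ˡ b) - toℕ (π ⟨$⟩ˡ c) ∣ ≟ 1)

separator? : ∀ {n} (π : Permutation′ n) → Decidable (Separator π)
separator? π i = verticalSeparator? π i ⊎-dec horizontalSeparator? π (π ⟨$⟩ʳ i)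

#separators : ∀ {n} → Permutation′ n → ℕ
#separators {n} π = length (filter (separator? π) (allFin n))

-- All of Sₙ, by choosing the image of the first position and then a
-- permutation of the rest.  The lemmas below show that every permutation is
-- listed exactly once, up to the pointwise equality _≈_, and that the list has
-- n ! entries.

permutations : ∀ n → List (Permutation′ n)
permutations zero    = id ∷ []
permutations (suc n) = cartesianProductWith (insert zero) (allFin (suc n)) (permutations n)

permutationSetoid : ℕ → Setoid 0ℓ 0ℓ
permutationSetoid n = record
  { Carrier       = Permutation′ n
  ; _≈_           = _≈_
  ; isEquivalence = record
    { refl  = λ _ → refl
    ; sym   = λ p i → sym (p i)
    ; trans = λ p q i → trans (p i) (q i)
    }
  }

private
  insert-cong : ∀ {n} j {π ρ : Permutation′ n} → π ≈ ρ → insert zero j π ≈ insert zero j ρ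
  insert-cong j         π≈ρ zero    = refl
  insert-cong j {π} {ρ} π≈ρ (suc i) =
    trans (insert-punchIn zero j π i)
      (trans (cong (punchIn j) (π≈ρ i)) (sym (insert-punchIn zero j ρ i)))

  length-cartesianProductWith : ∀ {A B C : Set} (f : A → B → C) xs ys →
                                length (cartesianProductWith f xs ys) ≡ length xs * length ys
  length-cartesianProductWith f []       ys = refl
  length-cartesianProductWith f (x ∷ xs) ys = trans (length-++ (map (f x) ys))
    (cong₂ _+_ (length-map (f x) ys) (length-cartesianProductWith f xs ys))

  insert-injective : ∀ {n} {j k} {π ρ : Permutation′ n} →
                     insert zero j π ≈ insert zero k ρ → j ≡ k × π ≈ ρ
  insert-injective {j = j} {π = π} {ρ} eq with refl ← eq zero =
    refl , λ i → punchIn-injective j _ _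
      (trans (sym (insert-punchIn zero j π i)) (trans (eq (suc i)) (insert-punchIn zero j ρ i)))

permutations-complete : ∀ {n} (π : Permutation′ n) →
                        let open Membership (permutationSetoid n) in π ∈ permutations n
permutations-complete {zero}  π = Any.here λ ()
permutations-complete {suc n} π =
  Any.cartesianProductWith⁺ (insert zero)
    (λ { {_} {ρ} refl q i → trans (sym (insert-remove zero π i)) (insert-cong _ {remove zero π} {ρ} q i) })
    (∈-allFin (π ⟨$⟩ʳ zero)) (permutations-complete (remove zero π))

permutations-unique : ∀ n → Unique.Unique (permutationSetoid n) (permutations n)
permutations-unique zero    = All.[] AllPairs.∷ AllPairs.[]
permutations-unique (suc n) =
  Unique.cartesianProductWith⁺ (setoid _) (permutationSetoid n) (permutationSetoid (suc n))
    (insert zero) (λ {_} {_} {π} {ρ} → insert-injective {π = π} {ρ})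
    (Unique≡.allFin⁺ (suc n)) (permutations-unique n)

length-permutations : ∀ n → length (permutations n) ≡ n !
length-permutations zero    = refl
length-permutations (suc n) = trans
  (length-cartesianProductWith (insert zero) (allFin (suc n)) (permutations n))
  (cong₂ _*_ (length-tabulate {n = suc n} (λ i → i)) (length-permutations n))

-- The expectation of X for π uniformly distributed on Sₙ.

expectation : ∀ n → (Permutation′ n → ℕ) → ℚ
expectation n X = ℚ._/_ (+ sum (map X (permutations n))) (n !) {{n !≢0}}

-- Every positive real bounds some positive rational from above, so letting ε
-- range over the positive rationals gives the usual notion of convergence.

TendsTo : (ℕ → ℚ) → ℚ → Set
TendsTo f L = ∀ ε → 0ℚ ℚ.< ε → ∃[ N ] ∀ n → N ≤ n → ℚ.∣ f n ℚ.- L ∣ ℚ.< ε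

-- For 3 ≤ n the truncated differences are the ordinary ones.

n[n-1][n-2]≢0 : ∀ {n} → 3 ≤ n → NonZero (n * (n ∸ 1) * (n ∸ 2))
n[n-1][n-2]≢0 (s≤s (s≤s (s≤s _))) = _

{-# OPTIONS --safe #-}
module Submission where

-- Deleting the digit a at position i of π ∈ S_{n+1} leaves ρ ∈ S_n.  Call (i , a)
-- a bond of ρ if the two positions around gap i hold the two values around gap a.
-- The deleted digit is a vertical separator iff row i has a bond outside column
-- a, and a horizontal one iff column a has a bond outside row i.  Rows and columns
-- contain at most one bond, so a permutation ρ with B bonds contributes
-- (2n + 1) B − B² to the total number of separators, and only the first two
-- moments of B are needed.  These satisfy recurrences obtained by inserting a new
-- first digit, which creates at most one bond and destroys at most one.

open import Defs
open import Data.Integer.Base using (+_; _+_; _-_; _*_; _^_)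
open import Data.Nat.Base as ℕ using (ℕ; _≤_; _∸_)
open import Data.Product.Base using (_×_)
open import Data.Rational.Base using (_/_)
open import Relation.Binary.PropositionalEquality using (_≡_)

import Data.Integer.Properties as ℤ
open import Algebra.Properties.Semiring.Sum ℤ.+-*-semiring
open import Data.Bool.Base using (if_then_else_)
open import Data.Fin.Base using (Fin; zero; suc; toℕ; punchIn; fromℕ<)
open import Data.Fin.Permutation
  using (Permutation′; _≈_; _⟨$⟩ʳ_; _⟨$⟩ˡ_; insert; remove; insert-remove; insert-punchIn;
         flip; inverseˡ; inverseʳ)
open import Data.Fin.Properties using (_≟_; punchIn-punchOut; toℕ<n; toℕ-fromℕ<; toℕ-injective)
open import Data.Integer.Base as ℤ using (ℤ; -_; 0ℤ; 1ℤ; +0; +[1+_]; -[1+_])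
open import Data.Integer.Tactic.RingSolver using (solve-∀)
open import Data.List.Base
  using (List; []; _∷_; _++_; map; filter; length; tabulate; allFin; cartesianProductWith)
open import Data.List.Membership.Propositional.Properties using (∈-allFin)
import Data.List.Membership.Setoid as Membership
open import Data.List.Properties using (length-++; length-map; length-removeAt′)
import Data.List.Relation.Unary.All as All
open import Data.List.Relation.Unary.AllPairs using (_∷_)
open import Data.List.Relation.Unary.Any as Any using (here; there)
import Data.List.Relation.Unary.Any.Properties as Any
import Data.List.Relation.Unary.Unique.Setoid as Unique
open import Data.Nat.Base using (zero; suc; _<_; s≤s; _!; _⊔_; ∣_-_∣)
open import Data.Nat.ListAction using () renaming (sum to ℕsum)
import Data.Nat.Properties as ℕ
import Data.Nat.Tactic.RingSolver as ℕSolver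
open import Data.Product.Base using (_,_)
open import Data.Rational.Base as ℚ using (ℚ; mkℚ; toℚᵘ; 0ℚ)
import Data.Rational.Properties as ℚ
open import Data.Rational.Unnormalised.Base as ℚᵘ using (mkℚᵘ; *≡*; *<*)
import Data.Rational.Unnormalised.Properties as ℚᵘ
open import Data.Sum.Base using (_⊎_; inj₁; inj₂; [_,_]′)
open import Function.Base using (_∘_)
open import Level using (0ℓ)
open import Relation.Binary.Bundles using (Setoid)
open import Relation.Binary.PropositionalEquality
  using (_≢_; _≗_; refl; sym; trans; cong; cong₂; subst; subst₂; module ≡-Reasoning)
open import Relation.Nullary.Decidable using (Dec; yes; no; does; _×-dec_; _⊎-dec_)
open import Relation.Nullary.Negation using (¬_; contradiction)
open import Relation.Unary using (Decidable)

-- Deletion makes the count tractable because the position can be fixed first: for each `i`,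
-- inserting every `a` at `i` into every ρ lists S_{n+1} once. The total is thus a sum, over ρ, of
-- the (n + 1)² insertions of one digit. There v + h - v h, with v = r - b and h = c - b, collapses
-- to r + c - r c - b, since b is absorbed by r and by c. The only nonlinear term r c factors over
-- the two indices and gives B²; this is what forces the second moment. The obstacle in the second
-- moment is that a new first digit may create one bond and destroy another at the same time. This
-- happens only if the destroyed bond joins the first two digits, so the recurrence closes once the
-- permutations beginning with two consecutive values, in either order, have been counted.

private variable
  A B C P Q : Set
  m n       : ℕ

-- Sums over lists and over all permutations

+-congˡ : ∀ a {b c} → b ≡ c → a + b ≡ a + c
+-congˡ a = cong (λ z → a + z)

sumOver : (A → ℤ) → List A → ℤ
sumOver f []       = 0ℤ
sumOver f (x ∷ xs) = f x + sumOver f xs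

sumOver-cong : {f g : A → ℤ} → f ≗ g → sumOver f ≗ sumOver g
sumOver-cong f≗g []       = refl
sumOver-cong f≗g (x ∷ xs) = cong₂ _+_ (f≗g x) (sumOver-cong f≗g xs)

sumOver-++ : (f : A → ℤ) (xs ys : List A) → sumOver f (xs ++ ys) ≡ sumOver f xs + sumOver f ys
sumOver-++ f []       ys = sym (ℤ.+-identityˡ _)
sumOver-++ f (x ∷ xs) ys = trans (+-congˡ (f x) (sumOver-++ f xs ys))
  (sym (ℤ.+-assoc (f x) (sumOver f xs) (sumOver f ys)))

sumOver-map : (f : B → ℤ) (g : A → B) (xs : List A) → sumOver f (map g xs) ≡ sumOver (f ∘ g) xs
sumOver-map f g []       = refl
sumOver-map f g (x ∷ xs) = +-congˡ (f (g x)) (sumOver-map f g xs)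

sumOver-tabulate : (f : A → ℤ) (g : Fin n → A) → sumOver f (tabulate g) ≡ sum (f ∘ g)
sumOver-tabulate {n = zero}  f g = refl
sumOver-tabulate {n = suc n} f g = +-congˡ (f (g zero)) (sumOver-tabulate f (g ∘ suc))

sumOver-cartesianProductWith :
  (f : C → ℤ) (g : A → B → C) (xs : List A) (ys : List B) →
  sumOver f (cartesianProductWith g xs ys) ≡ sumOver (λ x → sumOver (f ∘ g x) ys) xs
sumOver-cartesianProductWith f g []       ys = refl
sumOver-cartesianProductWith f g (x ∷ xs) ys =
  trans (sumOver-++ f (map (g x) ys) _)
    (cong₂ _+_ (sumOver-map f (g x) ys) (sumOver-cartesianProductWith f g xs ys))

sumOver-sum : (f : A → Fin n → ℤ) (xs : List A) →
              sumOver (λ x → sum (f x)) xs ≡ sum (λ i → sumOver (λ x → f x i) xs)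
sumOver-sum {n = n} f []       = sym (sum-replicate-zero n)
sumOver-sum         f (x ∷ xs) = trans (+-congˡ (sum (f x)) (sumOver-sum f xs)) (sym (∑-distrib-+ (f x) _))

length-cartesianProductWith : (g : A → B → C) (xs : List A) (ys : List B) →
                              length (cartesianProductWith g xs ys) ≡ length xs ℕ.* length ys
length-cartesianProductWith g []       ys = refl
length-cartesianProductWith g (x ∷ xs) ys = trans (length-++ (map (g x) ys))
  (cong₂ ℕ._+_ (length-map (g x) ys) (length-cartesianProductWith g xs ys))

-- Sums over two listings of the same elements of a setoid

module _ (S : Setoid 0ℓ 0ℓ) where
  open Setoid S using (Carrier) renaming (_≈_ to _∼_; sym to ∼-sym; trans to ∼-trans)
  open Membership S
  open Unique S using (Unique)

  private
    ∈-─ : ∀ {x z ys} (x∈ys : x ∈ ys) → z ∈ ys → ¬ x ∼ z → z ∈ (ys ─ x∈ys)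
    ∈-─ (here x∼y)   (here z∼y)   x≁z = contradiction (∼-trans x∼y (∼-sym z∼y)) x≁z
    ∈-─ (here _)     (there z∈ys) x≁z = z∈ys
    ∈-─ (there _)    (here z∼y)   x≁z = here z∼y
    ∈-─ (there x∈ys) (there z∈ys) x≁z = there (∈-─ x∈ys z∈ys x≁z)

    sumOver-─ : (f : Carrier → ℤ) → (∀ {x y} → x ∼ y → f x ≡ f y) →
                ∀ {x ys} (x∈ys : x ∈ ys) → f x + sumOver f (ys ─ x∈ys) ≡ sumOver f ys
    sumOver-─ f f-cong (here x∼y) = cong₂ _+_ (f-cong x∼y) refl
    sumOver-─ f f-cong {x} {y ∷ ys} (there x∈ys) =
      trans (swap (f x) (f y) _) (+-congˡ (f y) (sumOver-─ f f-cong x∈ys))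
      where
      swap : ∀ a b c → a + (b + c) ≡ b + (a + c)
      swap = solve-∀

  -- Induction on `xs`: the head is struck out of `ys`, and the remaining entries survive because
  -- none is equivalent to it. When `xs` is exhausted, equality of lengths leaves `ys` empty, so
  -- nothing in `ys` escapes the sum.
  sumOver-⊆ : (f : Carrier → ℤ) → (∀ {x y} → x ∼ y → f x ≡ f y) →
              ∀ {xs ys} → Unique xs → (∀ {z} → z ∈ xs → z ∈ ys) → length xs ≡ length ys →
              sumOver f xs ≡ sumOver f ys
  sumOver-⊆ f f-cong {[]}     {[]} _ _ _ = refl
  sumOver-⊆ f f-cong {x ∷ xs} {ys} (x≁xs ∷ xs!) xs⊆ys len =
    trans (+-congˡ (f x) (sumOver-⊆ f f-cong xs! (λ z∈xs → ∈-─ x∈ys (xs⊆ys (there z∈xs)) (x≁ z∈xs))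
                          (ℕ.suc-injective (trans len (length-removeAt′ ys (Any.index x∈ys))))))
      (sumOver-─ f f-cong x∈ys)
    where
    x∈ys = xs⊆ys (here (Setoid.refl S))

    x≁ : ∀ {z} → z ∈ xs → ¬ x ∼ z
    x≁ z∈xs x∼z = All.lookupWith (λ x≁y z∼y → x≁y (∼-trans x∼z z∼y)) x≁xs z∈xs

-- Sums over all permutations, by insertion at a chosen position

∑ₚ : (Permutation′ n → ℤ) → ℤ
∑ₚ {n} f = sumOver f (permutations n)

∑ₚ-insert-zero : (f : Permutation′ (suc n) → ℤ) →
                 ∑ₚ f ≡ ∑[ a < suc n ] ∑ₚ (f ∘ insert zero a)
∑ₚ-insert-zero {n} f =
  trans (sumOver-cartesianProductWith f (insert zero) (allFin (suc n)) (permutations n))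
    (sumOver-tabulate (λ a → ∑ₚ (f ∘ insert zero a)) (λ a → a))

insert-at : ∀ i j (π : Permutation′ n) → insert i j π ⟨$⟩ʳ i ≡ j
insert-at i j π with i ≟ i
... | yes _  = refl
... | no i≢i = contradiction refl i≢i

≈-punchIn : ∀ i {π ρ : Permutation′ (suc n)} → π ⟨$⟩ʳ i ≡ ρ ⟨$⟩ʳ i →
            (∀ k → π ⟨$⟩ʳ punchIn i k ≡ ρ ⟨$⟩ʳ punchIn i k) → π ≈ ρ
≈-punchIn i {π} {ρ} at off k with i ≟ k
... | yes refl = at
... | no  i≢k  = subst (λ k → π ⟨$⟩ʳ k ≡ ρ ⟨$⟩ʳ k) (punchIn-punchOut i≢k) (off _)

insert-cong : ∀ i j {π ρ : Permutation′ n} → π ≈ ρ → insert i j π ≈ insert i j ρ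
insert-cong i j {π} {ρ} π≈ρ =
  ≈-punchIn i {insert i j π} {insert i j ρ} (trans (insert-at i j π) (sym (insert-at i j ρ)))
    λ k → trans (insert-punchIn i j π k)
            (trans (cong (punchIn j) (π≈ρ k)) (sym (insert-punchIn i j ρ k)))

flip-cong : {π ρ : Permutation′ n} → π ≈ ρ → flip π ≈ flip ρ
flip-cong {π = π} {ρ} π≈ρ k = trans (cong (π ⟨$⟩ˡ_) (sym (trans (π≈ρ _) (inverseʳ ρ)))) (inverseˡ π)

flip-insert : ∀ i j (π : Permutation′ n) → flip (insert i j π) ≈ insert j i (flip π)
flip-insert i j π k with j ≟ k
... | yes _ = refl
... | no  _ = refl

-- `permutations` is built by insertion at position zero. Insertion at another position lists the
-- same classes in another order and through other representatives, so `f` must respect `_≈_` and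
-- the two lists are compared by completeness and length.
∑ₚ-insert : ∀ i (f : Permutation′ (suc n) → ℤ) → (∀ {π ρ} → π ≈ ρ → f π ≡ f ρ) →
            ∑ₚ f ≡ ∑[ a < suc n ] ∑ₚ (f ∘ insert i a)
∑ₚ-insert {n} i f f-cong = begin
  ∑ₚ f
    ≡⟨ sumOver-⊆ (permutationSetoid (suc n)) f (λ {π} {ρ} → f-cong {π} {ρ}) (permutations-unique (suc n))
         (λ {π} _ → complete π) lengths ⟩
  sumOver f (cartesianProductWith (insert i) (allFin (suc n)) (permutations n))
    ≡⟨ sumOver-cartesianProductWith f (insert i) (allFin (suc n)) (permutations n) ⟩
  sumOver (λ a → ∑ₚ (f ∘ insert i a)) (allFin (suc n))
    ≡⟨ sumOver-tabulate (λ a → ∑ₚ (f ∘ insert i a)) (λ a → a) ⟩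
  ∑[ a < suc n ] ∑ₚ (f ∘ insert i a) ∎
  where
  open ≡-Reasoning
  open Membership (permutationSetoid (suc n))

  complete : ∀ π → π ∈ cartesianProductWith (insert i) (allFin (suc n)) (permutations n)
  complete π = Any.cartesianProductWith⁺ (insert i)
    (λ { {_} {ρ} refl q k → trans (sym (insert-remove i π k)) (insert-cong i _ {remove i π} {ρ} q k) })
    (∈-allFin (π ⟨$⟩ʳ i)) (permutations-complete (remove i π))

  lengths : length (permutations (suc n)) ≡
            length (cartesianProductWith (insert i) (allFin (suc n)) (permutations n))
  lengths = trans (length-cartesianProductWith (insert zero) (allFin (suc n)) (permutations n))
    (sym (length-cartesianProductWith (insert i) (allFin (suc n)) (permutations n)))

-- Indicators

-- Integer values turn "present before, minus destroyed" and inclusion-exclusion into polynomial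
-- identities for the ring solver.
⟦_⟧ : Dec P → ℤ
⟦ p ⟧ = if does p then 1ℤ else 0ℤ

⟦⟧-cong : (p : Dec P) (q : Dec Q) → (P → Q) → (Q → P) → ⟦ p ⟧ ≡ ⟦ q ⟧
⟦⟧-cong (yes _) (yes _) _ _ = refl
⟦⟧-cong (yes p) (no ¬q) f _ = contradiction (f p) ¬q
⟦⟧-cong (no ¬p) (yes q) _ g = contradiction (g q) ¬p
⟦⟧-cong (no _)  (no _)  _ _ = refl

⟦⟧-no : (p : Dec P) → ¬ P → ⟦ p ⟧ ≡ 0ℤ
⟦⟧-no (yes p) ¬p = contradiction p ¬p
⟦⟧-no (no _)  _  = refl

⟦⟧-idem : (p : Dec P) → ⟦ p ⟧ * ⟦ p ⟧ ≡ ⟦ p ⟧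
⟦⟧-idem (yes _) = refl
⟦⟧-idem (no _)  = refl

⟦⟧-×-dec : (p : Dec P) (q : Dec Q) → ⟦ p ×-dec q ⟧ ≡ ⟦ p ⟧ * ⟦ q ⟧
⟦⟧-×-dec (yes _) (yes _) = refl
⟦⟧-×-dec (yes _) (no _)  = refl
⟦⟧-×-dec (no _)  _       = refl

⟦⟧-absorb : (p : Dec P) (q : Dec Q) → (P → Q) → ⟦ p ⟧ * ⟦ q ⟧ ≡ ⟦ p ⟧
⟦⟧-absorb (yes p) (yes _) _ = refl
⟦⟧-absorb (yes p) (no ¬q) f = contradiction (f p) ¬q
⟦⟧-absorb (no _)  _       _ = refl

⟦⟧-disjoint : (p : Dec P) (q : Dec Q) → (P → ¬ Q) → ⟦ p ⟧ * ⟦ q ⟧ ≡ 0ℤ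
⟦⟧-disjoint (yes p) (yes q) f = contradiction q (f p)
⟦⟧-disjoint (yes p) (no _)  f = refl
⟦⟧-disjoint (no _)  _       _ = refl

⟦⟧-⊎-dec : (p : Dec P) (q : Dec Q) → ⟦ p ⊎-dec q ⟧ ≡ ⟦ p ⟧ + ⟦ q ⟧ - ⟦ p ⟧ * ⟦ q ⟧
⟦⟧-⊎-dec (yes _) (yes _) = refl
⟦⟧-⊎-dec (yes _) (no _)  = refl
⟦⟧-⊎-dec (no _)  (yes _) = refl
⟦⟧-⊎-dec (no _)  (no _)  = refl

sum-zero : (f : Fin n → ℤ) → (∀ i → f i ≡ 0ℤ) → sum f ≡ 0ℤ
sum-zero {n} f f≗0 = trans (sum-cong-≗ f≗0) (sum-replicate-zero n)

sum-≟ : ∀ {t} → t < n → ∑[ a < n ] ⟦ toℕ a ℕ.≟ t ⟧ ≡ 1ℤ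
sum-≟ {suc n} {zero}  _         =
  +-congˡ 1ℤ (sum-zero (λ (a : Fin n) → ⟦ suc (toℕ a) ℕ.≟ 0 ⟧) λ _ → refl)
sum-≟ {suc n} {suc t} (s≤s t<n) =
  trans (ℤ.+-identityˡ _) (trans
    (sum-cong-≗ {n} (λ a → ⟦⟧-cong (suc (toℕ a) ℕ.≟ suc t) (toℕ a ℕ.≟ t) ℕ.suc-injective (cong suc)))
    (sum-≟ t<n))

-- Bonds

-- For a permutation of n digits the gaps are indexed by Fin (suc n): gap i lies
-- between position i − 1 and position i, so the extreme gaps have only one side.

data Sides (i : Fin (suc m)) : Set where
  outer : (∀ (x y : Fin m) → suc (toℕ x) ≡ toℕ i → toℕ y ≢ toℕ i) → Sides i
  inner : ∀ (x y : Fin m) → suc (toℕ x) ≡ toℕ i → toℕ y ≡ toℕ i → Sides i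

sides : (i : Fin (suc m)) → Sides i
sides zero = outer λ _ _ ()
sides {m} (suc i) with suc (toℕ i) ℕ.<? m
... | yes i+1<m = inner i (fromℕ< i+1<m) refl (toℕ-fromℕ< i+1<m)
... | no  i+1≮m = outer λ _ y _ y≡i+1 → i+1≮m (subst (_< m) y≡i+1 (toℕ<n y))

-- The common form of `row` (with `adjacent`) and `bond` (with `link a`): identities between the two
-- reduce to identities between the weights `W`, the extreme gaps contributing zero throughout.
gap : (A → A → ℤ) → (Fin m → A) → Fin (suc m) → ℤ
gap W g i with sides i
... | outer _       = 0ℤ
... | inner x y _ _ = W (g x) (g y)

gap-inner : (W : A → A → ℤ) (g : Fin m → A) (i : Fin (suc m)) {x y : Fin m} →
            suc (toℕ x) ≡ toℕ i → toℕ y ≡ toℕ i → gap W g i ≡ W (g x) (g y)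
gap-inner W g i {x} {y} x+1≡i y≡i with sides i
... | outer ¬xy                 = contradiction y≡i (¬xy x y x+1≡i)
... | inner x′ y′ x′+1≡i y′≡i = cong₂ (λ x y → W (g x) (g y))
  (toℕ-injective (ℕ.suc-injective (trans x′+1≡i (sym x+1≡i))))
  (toℕ-injective (trans y′≡i (sym y≡i)))

gap-outer : (W : A → A → ℤ) (g : Fin m → A) (i : Fin (suc m)) →
            (∀ x y → suc (toℕ x) ≡ toℕ i → toℕ y ≢ toℕ i) → gap W g i ≡ 0ℤ
gap-outer W g i ¬xy with sides i
... | outer _                 = refl
... | inner x y x+1≡i y≡i = contradiction y≡i (¬xy x y x+1≡i)

gap-cong : (W : A → A → ℤ) {f g : Fin m → A} → f ≗ g → gap W f ≗ gap W g
gap-cong W f≗g i with sides i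
... | outer _       = refl
... | inner x y _ _ = cong₂ W (f≗g x) (f≗g y)

-- The shift starts at gap two: gap one of `g` has `g zero` on its left, whereas gap zero of
-- `g ∘ suc` is extreme.
gap-suc : (W : A → A → ℤ) (g : Fin (suc m) → A) (i : Fin m) →
          gap W g (suc (suc i)) ≡ gap W (g ∘ suc) (suc i)
gap-suc W g i with sides (suc i)
... | inner x y x+1≡i+1 y≡i+1 = gap-inner W g (suc (suc i)) {suc x} {suc y} (cong suc x+1≡i+1) (cong suc y≡i+1)
... | outer ¬xy               = gap-outer W g (suc (suc i)) λ
  { (suc x) (suc y) p q → ¬xy x y (ℕ.suc-injective p) (ℕ.suc-injective q) }

-- Adjacent values, and the effect of inserting a value

adjacent : Fin n → Fin n → ℤ
adjacent u v = ⟦ ∣ toℕ u - toℕ v ∣ ℕ.≟ 1 ⟧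

∣m-n∣≡1⇒consecutive : ∀ m n → ∣ m - n ∣ ≡ 1 → suc m ≡ n ⊎ m ≡ suc n
∣m-n∣≡1⇒consecutive zero    (suc zero) _ = inj₁ refl
∣m-n∣≡1⇒consecutive (suc zero) zero    _ = inj₂ refl
∣m-n∣≡1⇒consecutive (suc m) (suc n)    p with ∣m-n∣≡1⇒consecutive m n p
... | inj₁ q = inj₁ (cong suc q)
... | inj₂ q = inj₂ (cong suc q)

∣m-1+m∣≡1 : ∀ m → ∣ m - suc m ∣ ≡ 1
∣m-1+m∣≡1 zero    = refl
∣m-1+m∣≡1 (suc m) = ∣m-1+m∣≡1 m

∣1+m-m∣≡1 : ∀ m → ∣ suc m - m ∣ ≡ 1
∣1+m-m∣≡1 zero    = refl
∣1+m-m∣≡1 (suc m) = ∣1+m-m∣≡1 m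

-- The values u and v are, in some order, the two sides a − 1 and a of gap a.

Link : ℕ → ℕ → ℕ → Set
Link a u v = a ≡ u ⊔ v × ∣ u - v ∣ ≡ 1

link? : ∀ a u v → Dec (Link a u v)
link? a u v = (a ℕ.≟ u ⊔ v) ×-dec (∣ u - v ∣ ℕ.≟ 1)

link : Fin (suc n) → Fin n → Fin n → ℤ
link a u v = ⟦ link? (toℕ a) (toℕ u) (toℕ v) ⟧

Link⇒ : ∀ {a u v} → Link a u v → suc u ≡ a × v ≡ a ⊎ suc v ≡ a × u ≡ a
Link⇒ {a} {u} {v} (a≡u⊔v , p) with ∣m-n∣≡1⇒consecutive u v p
... | inj₁ refl = let v≡a = trans (sym (ℕ.m≤n⇒m⊔n≡n (ℕ.n≤1+n u))) (sym a≡u⊔v) in inj₁ (v≡a , v≡a)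
... | inj₂ refl = let u≡a = trans (sym (ℕ.m≥n⇒m⊔n≡m (ℕ.n≤1+n v))) (sym a≡u⊔v) in inj₂ (u≡a , u≡a)

⇒Link : ∀ {a u v} → suc u ≡ a → v ≡ a → Link a u v
⇒Link {u = u} refl refl = sym (ℕ.m≤n⇒m⊔n≡n (ℕ.n≤1+n u)) , ∣m-1+m∣≡1 u

⇒Link′ : ∀ {a u v} → suc v ≡ a → u ≡ a → Link a u v
⇒Link′ {v = v} refl refl = sym (ℕ.m≥n⇒m⊔n≡m (ℕ.n≤1+n v)) , ∣1+m-m∣≡1 v

-- Making room for the value a widens only the distances across gap a. The one adjacent pair across
-- that gap is a - 1, a, which is exactly what `link a` detects, and no pair becomes adjacent.
adjacent-punchIn : ∀ (a : Fin (suc n)) u v →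
                   adjacent (punchIn a u) (punchIn a v) + link a u v ≡ adjacent u v
adjacent-punchIn zero          zero          zero          = refl
adjacent-punchIn zero          zero          (suc v)       = ℤ.+-identityʳ _
adjacent-punchIn zero          (suc u)       zero          = ℤ.+-identityʳ _
adjacent-punchIn zero          (suc u)       (suc v)       = ℤ.+-identityʳ _
adjacent-punchIn (suc a)       zero          zero          = refl
adjacent-punchIn (suc zero)    zero          (suc zero)    = refl
adjacent-punchIn (suc zero)    zero          (suc (suc v)) = refl
adjacent-punchIn (suc (suc a)) zero          (suc zero)    = refl
adjacent-punchIn (suc (suc a)) zero          (suc (suc v)) = trans (ℤ.+-identityˡ _)
  (⟦⟧-no (link? (suc (suc (toℕ a))) 0 (suc (suc (toℕ v)))) λ ())
adjacent-punchIn (suc zero)    (suc zero)    zero          = refl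
adjacent-punchIn (suc zero)    (suc (suc u)) zero          = refl
adjacent-punchIn (suc (suc a)) (suc zero)    zero          = refl
adjacent-punchIn (suc (suc a)) (suc (suc u)) zero          = trans (ℤ.+-identityˡ _)
  (⟦⟧-no (link? (suc (suc (toℕ a))) (suc (suc (toℕ u))) 0) λ ())
adjacent-punchIn (suc a)       (suc u)       (suc v)       = adjacent-punchIn a u v

-- Adjacent values surround a single gap, the one indexed by their maximum; the maximum in `Link`
-- makes this a sum of the indicator of one point.
sum-link : (u v : Fin n) → ∑[ a < suc n ] link a u v ≡ adjacent u v
sum-link {n} u v = begin
  ∑[ a < suc n ] link a u v
    ≡⟨ sum-cong-≗ {suc n} (λ a → ⟦⟧-×-dec (toℕ a ℕ.≟ toℕ u ⊔ toℕ v) (∣ toℕ u - toℕ v ∣ ℕ.≟ 1)) ⟩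
  ∑[ a < suc n ] (⟦ toℕ a ℕ.≟ toℕ u ⊔ toℕ v ⟧ * adjacent u v)
    ≡⟨ *-distribʳ-sum {suc n} (adjacent u v) (λ a → ⟦ toℕ a ℕ.≟ toℕ u ⊔ toℕ v ⟧) ⟨
  ∑[ a < suc n ] ⟦ toℕ a ℕ.≟ toℕ u ⊔ toℕ v ⟧ * adjacent u v
    ≡⟨ cong (_* adjacent u v) (sum-≟ {suc n} (ℕ.m≤n⇒m≤1+n (ℕ.⊔-lub (toℕ<n u) (toℕ<n v)))) ⟩
  1ℤ * adjacent u v
    ≡⟨ ℤ.*-identityˡ _ ⟩
  adjacent u v ∎
  where open ≡-Reasoning

-- A digit a put in front of the digit w (before w is shifted by the insertion of a)
-- forms a bond with it.

near : Fin (suc n) → Fin n → ℤ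
near a w = adjacent a (punchIn a w)

near⇒ : (a : Fin (suc n)) (w : Fin n) → ∣ toℕ a - toℕ (punchIn a w) ∣ ≡ 1 →
        toℕ w ≡ toℕ a ⊎ suc (toℕ w) ≡ toℕ a
near⇒ zero          zero    _ = inj₁ refl
near⇒ (suc zero)    zero    _ = inj₂ refl
near⇒ (suc a)       (suc w) p with near⇒ a w p
... | inj₁ q = inj₁ (cong suc q)
... | inj₂ q = inj₂ (cong suc q)

⇒near : (a : Fin (suc n)) (w : Fin n) → toℕ w ≡ toℕ a ⊎ suc (toℕ w) ≡ toℕ a →
        ∣ toℕ a - toℕ (punchIn a w) ∣ ≡ 1
⇒near zero          zero    _ = refl
⇒near (suc zero)    zero    _ = refl
⇒near zero          (suc w) (inj₁ ())
⇒near zero          (suc w) (inj₂ ())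
⇒near (suc (suc a)) zero    (inj₁ ())
⇒near (suc (suc a)) zero    (inj₂ ())
⇒near (suc a)       (suc w) (inj₁ q) = ⇒near a w (inj₁ (ℕ.suc-injective q))
⇒near (suc a)       (suc w) (inj₂ q) = ⇒near a w (inj₂ (ℕ.suc-injective q))

-- The new digit may land just below w (a = w) or just above it (a = w + 1); both choices always
-- exist, as there is one more gap than there are values.
sum-near : (w : Fin n) → ∑[ a < suc n ] near a w ≡ + 2
sum-near {suc n} zero    = +-congˡ 1ℤ (+-congˡ 1ℤ (sum-replicate-zero n))
sum-near {suc n} (suc w) = trans (ℤ.+-identityˡ _) (sum-near w)

link-near : ∀ a (u v : Fin n) → link a u v * near a u ≡ link a u v
link-near a u v = ⟦⟧-absorb (link? (toℕ a) (toℕ u) (toℕ v)) (∣ toℕ a - toℕ (punchIn a u) ∣ ℕ.≟ 1)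
  λ l → ⇒near a u ([ (λ (p , _) → inj₂ p) , (λ (_ , q) → inj₁ q) ]′ (Link⇒ l))

-- `near a` accepts only the values a - 1 and a, and a link at gap a means that u and v already are
-- these two.
link-near-≢ : ∀ a {u v w : Fin n} → w ≢ u → w ≢ v → link a u v * near a w ≡ 0ℤ
link-near-≢ a {u} {v} {w} w≢u w≢v =
  ⟦⟧-disjoint (link? (toℕ a) (toℕ u) (toℕ v)) (∣ toℕ a - toℕ (punchIn a w) ∣ ℕ.≟ 1)
  λ l p → disjoint (Link⇒ l) (near⇒ a w p)
  where
  disjoint : suc (toℕ u) ≡ toℕ a × toℕ v ≡ toℕ a ⊎ suc (toℕ v) ≡ toℕ a × toℕ u ≡ toℕ a →
             ¬ (toℕ w ≡ toℕ a ⊎ suc (toℕ w) ≡ toℕ a)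
  disjoint (inj₁ (p , q)) (inj₁ r) = w≢v (toℕ-injective (trans r (sym q)))
  disjoint (inj₁ (p , q)) (inj₂ r) = w≢u (toℕ-injective (ℕ.suc-injective (trans r (sym p))))
  disjoint (inj₂ (p , q)) (inj₁ r) = w≢u (toℕ-injective (trans r (sym q)))
  disjoint (inj₂ (p , q)) (inj₂ r) = w≢v (toℕ-injective (ℕ.suc-injective (trans r (sym p))))

-- The bond matrix, its rows and its columns

bond : Permutation′ n → Fin (suc n) → Fin (suc n) → ℤ
bond π i a = gap (link a) (π ⟨$⟩ʳ_) i

row : Permutation′ n → Fin (suc n) → ℤ
row π = gap adjacent (π ⟨$⟩ʳ_)

column : Permutation′ n → Fin (suc n) → ℤ
column π = row (flip π)

flip-unique : (π : Permutation′ n) {x u : Fin n} → toℕ (π ⟨$⟩ʳ x) ≡ toℕ u → π ⟨$⟩ˡ u ≡ x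
flip-unique π p = trans (cong (π ⟨$⟩ˡ_) (sym (toℕ-injective p))) (inverseˡ π)

Link-flip : (π : Permutation′ n) (i a : Fin (suc n)) {x y u v : Fin n} →
            suc (toℕ x) ≡ toℕ i → toℕ y ≡ toℕ i → suc (toℕ u) ≡ toℕ a → toℕ v ≡ toℕ a →
            Link (toℕ a) (toℕ (π ⟨$⟩ʳ x)) (toℕ (π ⟨$⟩ʳ y)) →
            Link (toℕ i) (toℕ (π ⟨$⟩ˡ u)) (toℕ (π ⟨$⟩ˡ v))
Link-flip π i a {x} {y} {u} {v} x+1≡i y≡i u+1≡a v≡a l with Link⇒ l
... | inj₁ (πx+1≡a , πy≡a) = ⇒Link
  (trans (cong (suc ∘ toℕ) (flip-unique π (ℕ.suc-injective (trans πx+1≡a (sym u+1≡a))))) x+1≡i)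
  (trans (cong toℕ (flip-unique π (trans πy≡a (sym v≡a)))) y≡i)
... | inj₂ (πy+1≡a , πx≡a) = ⇒Link′
  (trans (cong (suc ∘ toℕ) (flip-unique π (trans πx≡a (sym v≡a)))) x+1≡i)
  (trans (cong toℕ (flip-unique π (ℕ.suc-injective (trans πy+1≡a (sym u+1≡a))))) y≡i)

bond-outer : (π : Permutation′ n) (i a : Fin (suc n)) →
             (∀ u v → suc (toℕ u) ≡ toℕ a → toℕ v ≢ toℕ a) → bond π i a ≡ 0ℤ
bond-outer π i a ¬uv with sides i
... | outer _       = refl
... | inner x y _ _ = ⟦⟧-no (link? (toℕ a) (toℕ (π ⟨$⟩ʳ x)) (toℕ (π ⟨$⟩ʳ y)))
  λ l → [ (λ (p , q) → ¬uv (π ⟨$⟩ʳ x) (π ⟨$⟩ʳ y) p q)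
        , (λ (p , q) → ¬uv (π ⟨$⟩ʳ y) (π ⟨$⟩ʳ x) p q) ]′ (Link⇒ l)

-- In the diagram of π, a bond is a pair of points on a diagonal of the two-by-two block at gaps i
-- and a; inversion reflects the diagram and maps the block to the one at gaps a and i. If either
-- gap is extreme, both sides vanish.
bond-flip : (π : Permutation′ n) (i a : Fin (suc n)) → bond π i a ≡ bond (flip π) a i
bond-flip π i a = cases (sides i) (sides a)
  where
  cases : Sides i → Sides a → bond π i a ≡ bond (flip π) a i
  cases (outer ¬xy) _ = trans (gap-outer (link a) (π ⟨$⟩ʳ_) i ¬xy) (sym (bond-outer (flip π) a i ¬xy))
  cases _ (outer ¬uv) = trans (bond-outer π i a ¬uv) (sym (gap-outer (link i) (π ⟨$⟩ˡ_) a ¬uv))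
  cases (inner x y x+1≡i y≡i) (inner u v u+1≡a v≡a) =
    trans (gap-inner (link a) (π ⟨$⟩ʳ_) i x+1≡i y≡i)
      (trans (⟦⟧-cong (link? (toℕ a) (toℕ (π ⟨$⟩ʳ x)) (toℕ (π ⟨$⟩ʳ y)))
                      (link? (toℕ i) (toℕ (π ⟨$⟩ˡ u)) (toℕ (π ⟨$⟩ˡ v)))
                (Link-flip π i a x+1≡i y≡i u+1≡a v≡a) (Link-flip (flip π) a i u+1≡a v≡a x+1≡i y≡i))
        (sym (gap-inner (link i) (π ⟨$⟩ˡ_) a u+1≡a v≡a)))

sum-bond : (π : Permutation′ n) (i : Fin (suc n)) → ∑[ a < suc n ] bond π i a ≡ row π i
sum-bond {n} π i with sides i
... | outer _       = sum-replicate-zero (suc n)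
... | inner x y _ _ = sum-link (π ⟨$⟩ʳ x) (π ⟨$⟩ʳ y)

bond-row : (π : Permutation′ n) (i a : Fin (suc n)) → bond π i a * row π i ≡ bond π i a
bond-row π i a with sides i
... | outer _       = refl
... | inner x y _ _ = ⟦⟧-absorb (link? (toℕ a) (toℕ (π ⟨$⟩ʳ x)) (toℕ (π ⟨$⟩ʳ y)))
  (∣ toℕ (π ⟨$⟩ʳ x) - toℕ (π ⟨$⟩ʳ y) ∣ ℕ.≟ 1) λ (_ , p) → p

bond-idem : (π : Permutation′ n) (i a : Fin (suc n)) → bond π i a * bond π i a ≡ bond π i a
bond-idem π i a with sides i
... | outer _       = refl
... | inner x y _ _ = ⟦⟧-idem (link? (toℕ a) (toℕ (π ⟨$⟩ʳ x)) (toℕ (π ⟨$⟩ʳ y)))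

row-idem : (π : Permutation′ n) (i : Fin (suc n)) → row π i * row π i ≡ row π i
row-idem π i with sides i
... | outer _       = refl
... | inner x y _ _ = ⟦⟧-idem (∣ toℕ (π ⟨$⟩ʳ x) - toℕ (π ⟨$⟩ʳ y) ∣ ℕ.≟ 1)

-- When an inserted digit is a separator

gap-punchIn : (π : Permutation′ n) (i a : Fin (suc n)) →
              gap adjacent (punchIn a ∘ (π ⟨$⟩ʳ_)) i ≡ row π i - bond π i a
gap-punchIn π i a with sides i
... | outer _       = refl
... | inner x y _ _ = subtract (adjacent-punchIn a (π ⟨$⟩ʳ x) (π ⟨$⟩ʳ y))
  where
  cancel : ∀ p q → p ≡ p + q - q
  cancel = solve-∀
  subtract : ∀ {p q r} → p + q ≡ r → p ≡ r - q
  subtract {p} {q} refl = cancel p q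

-- The neighbours of the inserted digit are the two sides of gap i in `π`, with values shifted to
-- make room for a. They are adjacent unless a itself falls between them, which accounts for the
-- subtracted bond.
VerticalSeparator-insert : (i a : Fin (suc n)) (π : Permutation′ n) →
  ⟦ verticalSeparator? (insert i a π) i ⟧ ≡ row π i - bond π i a
VerticalSeparator-insert {n} i a π = trans (cases (sides i)) (gap-punchIn π i a)
  where
  σ = insert i a π

  cases : Sides i → ⟦ verticalSeparator? σ i ⟧ ≡ gap adjacent (punchIn a ∘ (π ⟨$⟩ʳ_)) i
  cases (outer ¬xy) = trans (⟦⟧-no (verticalSeparator? σ i) none) (sym (gap-outer adjacent _ i ¬xy))
    where
    -- A predecessor and a successor of i among n + 1 positions would make i - 1 and i both
    -- positions of `π`, so gap i would have two sides.
    none : ¬ VerticalSeparator σ i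
    none (j , k , j+1≡i , k≡i+1 , _) = ¬xy (fromℕ< j<n) (fromℕ< i<n)
      (trans (cong suc (toℕ-fromℕ< j<n)) j+1≡i) (toℕ-fromℕ< i<n)
      where
      i<n : toℕ i < n
      i<n = ℕ.s≤s⁻¹ (subst (_< suc n) k≡i+1 (toℕ<n k))
      j<n : toℕ j < n
      j<n = ℕ.<-trans (ℕ.≤-reflexive j+1≡i) i<n
  cases (inner x y x+1≡i y≡i) = trans
    (⟦⟧-cong (verticalSeparator? σ i)
      (∣ toℕ (punchIn a (π ⟨$⟩ʳ x)) - toℕ (punchIn a (π ⟨$⟩ʳ y)) ∣ ℕ.≟ 1)
      (λ (j , k , j+1≡i , k≡i+1 , p) → subst₂ (λ j k → ∣ toℕ j - toℕ k ∣ ≡ 1)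
        (trans (cong (σ ⟨$⟩ʳ_) (toℕ-injective (ℕ.suc-injective (trans j+1≡i (sym below)))))
          (insert-punchIn i a π x))
        (trans (cong (σ ⟨$⟩ʳ_) (toℕ-injective (trans k≡i+1 (sym above)))) (insert-punchIn i a π y)) p)
      (λ p → punchIn i x , punchIn i y , below , above ,
        subst₂ (λ j k → ∣ toℕ j - toℕ k ∣ ≡ 1) (sym (insert-punchIn i a π x)) (sym (insert-punchIn i a π y)) p))
    (sym (gap-inner adjacent _ i x+1≡i y≡i))
    where
    toℕ-punchIn-< : ∀ {n} (i : Fin (suc n)) x → toℕ x < toℕ i → toℕ (punchIn i x) ≡ toℕ x
    toℕ-punchIn-< (suc i) zero    _         = refl
    toℕ-punchIn-< (suc i) (suc x) (s≤s x<i) = cong suc (toℕ-punchIn-< i x x<i)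

    toℕ-punchIn-≥ : ∀ {n} (i : Fin (suc n)) x → toℕ i ≤ toℕ x → toℕ (punchIn i x) ≡ suc (toℕ x)
    toℕ-punchIn-≥ zero    x       _         = refl
    toℕ-punchIn-≥ (suc i) (suc x) (s≤s i≤x) = cong suc (toℕ-punchIn-≥ i x i≤x)

    below : suc (toℕ (punchIn i x)) ≡ toℕ i
    below = trans (cong suc (toℕ-punchIn-< i x (ℕ.≤-reflexive x+1≡i))) x+1≡i

    above : toℕ (punchIn i y) ≡ suc (toℕ i)
    above = trans (toℕ-punchIn-≥ i y (ℕ.≤-reflexive (sym y≡i))) (cong suc y≡i)

VerticalSeparator-cong : {π ρ : Permutation′ n} {i : Fin n} → π ≈ ρ →
                         VerticalSeparator π i → VerticalSeparator ρ i
VerticalSeparator-cong π≈ρ (j , k , p , q , r) =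
  j , k , p , q , subst₂ (λ j k → ∣ toℕ j - toℕ k ∣ ≡ 1) (π≈ρ j) (π≈ρ k) r

-- A horizontal separator of σ is by definition a vertical one of `flip σ`, and inverting an
-- insertion swaps the roles of i and a.
HorizontalSeparator-insert : (i a : Fin (suc n)) (π : Permutation′ n) →
  ⟦ horizontalSeparator? (insert i a π) a ⟧ ≡ column π a - bond π i a
HorizontalSeparator-insert i a π = begin
  ⟦ verticalSeparator? (flip (insert i a π)) a ⟧
    ≡⟨ ⟦⟧-cong (verticalSeparator? (flip (insert i a π)) a) (verticalSeparator? (insert a i (flip π)) a)
         (VerticalSeparator-cong {π = flip (insert i a π)} {insert a i (flip π)} (flip-insert i a π))
         (VerticalSeparator-cong {π = insert a i (flip π)} {flip (insert i a π)} (sym ∘ flip-insert i a π)) ⟩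
  ⟦ verticalSeparator? (insert a i (flip π)) a ⟧
    ≡⟨ VerticalSeparator-insert a i (flip π) ⟩
  column π a - bond (flip π) a i
    ≡⟨ cong (λ b → column π a - b) (bond-flip π i a) ⟨
  column π a - bond π i a ∎
  where open ≡-Reasoning

-- Counting separators over all insertions of one digit

private
  linear-step : ∀ l k p q r f g h F G H →
    (k + p * f + q * g + r * h) + (l * k + p * F + q * G + r * H) ≡
    (1ℤ + l) * k + p * (f + F) + q * (g + G) + r * (h + H)
  linear-step = solve-∀

  linear-zero : ∀ k p q r → 0ℤ ≡ 0ℤ * k + p * 0ℤ + q * 0ℤ + r * 0ℤ
  linear-zero = solve-∀

-- A constant and three terms are what the longest sum, that of the squares in `sum-bonds²-insert`,
-- requires; shorter sums are padded with zeros.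
sum-linear : ∀ k p q r (f g h : Fin n → ℤ) →
             ∑[ i < n ] (k + p * f i + q * g i + r * h i) ≡ + n * k + p * sum f + q * sum g + r * sum h
sum-linear {zero}  k p q r f g h = linear-zero k p q r
sum-linear {suc n} k p q r f g h = trans
  (+-congˡ (k + p * f zero + q * g zero + r * h zero) (sum-linear k p q r (f ∘ suc) (g ∘ suc) (h ∘ suc)))
  (linear-step (+ n) k p q r _ _ _ _ _ _)

sumOver-linear : ∀ k p q r (f g h : A → ℤ) (xs : List A) →
                 sumOver (λ x → k + p * f x + q * g x + r * h x) xs ≡
                 + length xs * k + p * sumOver f xs + q * sumOver g xs + r * sumOver h xs
sumOver-linear k p q r f g h []       = linear-zero k p q r
sumOver-linear k p q r f g h (x ∷ xs) = trans
  (+-congˡ (k + p * f x + q * g x + r * h x) (sumOver-linear k p q r f g h xs))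
  (linear-step (+ length xs) k p q r _ _ _ _ _ _)

bonds : Permutation′ n → ℤ
bonds π = sum (row π)

sum-bondˡ : (π : Permutation′ n) (a : Fin (suc n)) → ∑[ i < suc n ] bond π i a ≡ column π a
sum-bondˡ {n} π a = trans (sum-cong-≗ {suc n} (λ i → bond-flip π i a)) (sum-bond (flip π) a)

sum-column : (π : Permutation′ n) → sum (column π) ≡ bonds π
sum-column {n} π = begin
  sum (column π)                               ≡⟨ sum-cong-≗ {suc n} (sum-bondˡ π) ⟨
  ∑[ a < suc n ] ∑[ i < suc n ] bond π i a     ≡⟨ ∑-comm {suc n} {suc n} (λ a i → bond π i a) ⟩
  ∑[ i < suc n ] ∑[ a < suc n ] bond π i a     ≡⟨ sum-cong-≗ {suc n} (sum-bond π) ⟩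
  bonds π                                      ∎
  where open ≡-Reasoning

bond-column : (π : Permutation′ n) (i a : Fin (suc n)) → bond π i a * column π a ≡ bond π i a
bond-column π i a = begin
  bond π i a * column π a         ≡⟨ cong (_* column π a) (bond-flip π i a) ⟩
  bond (flip π) a i * column π a  ≡⟨ bond-row (flip π) a i ⟩
  bond (flip π) a i               ≡⟨ bond-flip π i a ⟨
  bond π i a                      ∎
  where open ≡-Reasoning

-- With r, c, b the entries of row, column and bond, this is v + h − v h for
-- v = r − b and h = c − b; the trailing 0ℤ is the term of sum-linear left unused.

Separator-insert : (i a : Fin (suc n)) (π : Permutation′ n) →
  ⟦ separator? (insert i a π) i ⟧ ≡
  row π i + (1ℤ - row π i) * column π a + (- 1ℤ) * bond π i a + 0ℤ
Separator-insert i a π = begin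
  ⟦ separator? (insert i a π) i ⟧
    ≡⟨ ⟦⟧-⊎-dec (verticalSeparator? (insert i a π) i) (horizontalSeparator? (insert i a π) (insert i a π ⟨$⟩ʳ i)) ⟩
  _ ≡⟨ cong₂ (λ v h → v + h - v * h) (VerticalSeparator-insert i a π)
         (trans (cong (λ b → ⟦ horizontalSeparator? (insert i a π) b ⟧) (insert-at i a π))
           (HorizontalSeparator-insert i a π)) ⟩
  (r - b) + (c - b) - (r - b) * (c - b)
    ≡⟨ expand r c b ⟩
  r + c - r * c + (b * r + b * c - b * b) - + 2 * b
    ≡⟨ cong (λ z → r + c - r * c + z - + 2 * b)
         (cong₂ _-_ (cong₂ _+_ (bond-row π i a) (bond-column π i a)) (bond-idem π i a)) ⟩
  r + c - r * c + (b + b - b) - + 2 * b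
    ≡⟨ collect r c b ⟩
  r + (1ℤ - r) * c + (- 1ℤ) * b + 0ℤ ∎
  where
  open ≡-Reasoning
  r = row π i
  c = column π a
  b = bond π i a

  expand : ∀ r c b → (r - b) + (c - b) - (r - b) * (c - b) ≡ r + c - r * c + (b * r + b * c - b * b) - + 2 * b
  expand = solve-∀
  collect : ∀ r c b → r + c - r * c + (b + b - b) - + 2 * b ≡ r + (1ℤ - r) * c + (- 1ℤ) * b + 0ℤ
  collect = solve-∀

-- Columns sum to β and the bonds of row i to its entry r, so each i contributes β + (n - β) r;
-- summing r over i gives β once more, whence β².
sum-Separator-insert : (π : Permutation′ n) →
  ∑[ i < suc n ] ∑[ a < suc n ] ⟦ separator? (insert i a π) i ⟧ ≡
  0ℤ + (+ 2 * + n + 1ℤ) * bonds π + (- 1ℤ) * (bonds π * bonds π) + 0ℤ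
sum-Separator-insert {n} π = begin
  ∑[ i < suc n ] ∑[ a < suc n ] ⟦ separator? (insert i a π) i ⟧
    ≡⟨ sum-cong-≗ {suc n} inner-sum ⟩
  ∑[ i < suc n ] (β + (+ n - β) * row π i + 0ℤ + 0ℤ)
    ≡⟨ sum-linear {suc n} β (+ n - β) 0ℤ 0ℤ (row π) (λ _ → 0ℤ) (λ _ → 0ℤ) ⟩
  + suc n * β + (+ n - β) * β + 0ℤ + 0ℤ
    ≡⟨ collect (+ n) β ⟩
  0ℤ + (+ 2 * + n + 1ℤ) * β + (- 1ℤ) * (β * β) + 0ℤ ∎
  where
  open ≡-Reasoning
  β = bonds π

  collect : ∀ n β → (1ℤ + n) * β + (n - β) * β + 0ℤ + 0ℤ ≡
            0ℤ + (+ 2 * n + 1ℤ) * β + (- 1ℤ) * (β * β) + 0ℤ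
  collect = solve-∀

  rearrange : ∀ n r β → (1ℤ + n) * r + (1ℤ - r) * β + (- 1ℤ) * r + 0ℤ ≡
              β + (n - β) * r + 0ℤ + 0ℤ
  rearrange = solve-∀

  inner-sum : ∀ i → ∑[ a < suc n ] ⟦ separator? (insert i a π) i ⟧ ≡
                    β + (+ n - β) * row π i + 0ℤ + 0ℤ
  inner-sum i = begin
    ∑[ a < suc n ] ⟦ separator? (insert i a π) i ⟧
      ≡⟨ sum-cong-≗ {suc n} (λ a → Separator-insert i a π) ⟩
    ∑[ a < suc n ] (r + (1ℤ - r) * column π a + (- 1ℤ) * bond π i a + 0ℤ)
      ≡⟨ sum-linear {suc n} r (1ℤ - r) (- 1ℤ) 0ℤ (column π) (bond π i) (λ _ → 0ℤ) ⟩
    + suc n * r + (1ℤ - r) * sum (column π) + (- 1ℤ) * sum (bond π i) + 0ℤ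
      ≡⟨ cong₂ (λ x y → + suc n * r + (1ℤ - r) * x + (- 1ℤ) * y + 0ℤ)
           (sum-column π) (sum-bond π i) ⟩
    + suc n * r + (1ℤ - r) * β + (- 1ℤ) * r + 0ℤ
      ≡⟨ rearrange (+ n) r β ⟩
    β + (+ n - β) * r + 0ℤ + 0ℤ ∎
    where r = row π i

-- Moments of the number of bonds

row-insert-one : (a : Fin (suc (suc n))) (π : Permutation′ (suc n)) →
                 row (insert zero a π) (suc zero) ≡ near a (π ⟨$⟩ʳ zero)
row-insert-one a π = trans
  (gap-inner adjacent (insert zero a π ⟨$⟩ʳ_) (suc zero) {zero} {suc zero} refl refl)
  (cong (adjacent a) (insert-punchIn zero a π zero))

row-insert-suc : (a : Fin (suc n)) (π : Permutation′ n) (i : Fin n) →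
                 row (insert zero a π) (suc (suc i)) ≡ row π (suc i) - bond π (suc i) a
row-insert-suc a π i = begin
  row (insert zero a π) (suc (suc i))
    ≡⟨ gap-suc adjacent (insert zero a π ⟨$⟩ʳ_) i ⟩
  gap adjacent ((insert zero a π ⟨$⟩ʳ_) ∘ suc) (suc i)
    ≡⟨ gap-cong adjacent (insert-punchIn zero a π) (suc i) ⟩
  gap adjacent (punchIn a ∘ (π ⟨$⟩ʳ_)) (suc i)
    ≡⟨ gap-punchIn π (suc i) a ⟩
  row π (suc i) - bond π (suc i) a ∎
  where open ≡-Reasoning

sum-minus : (f g : Fin n → ℤ) → ∑[ i < n ] (f i - g i) ≡ sum f - sum g
sum-minus {zero}  f g = refl
sum-minus {suc n} f g = trans (+-congˡ (f zero - g zero) (sum-minus (f ∘ suc) (g ∘ suc)))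
  (interchange (f zero) (g zero) _ _)
  where
  interchange : ∀ a b c d → a - b + (c - d) ≡ a + c - (b + d)
  interchange = solve-∀

-- Insertion in front separates no two neighbouring positions, so the only bond lost is one between
-- the values a - 1 and a. This is the reason for inserting at position zero.
bonds-insert : (a : Fin (suc (suc n))) (π : Permutation′ (suc n)) →
               bonds (insert zero a π) ≡ bonds π + near a (π ⟨$⟩ʳ zero) - column π a
bonds-insert {n} a π = begin
  bonds (insert zero a π)
    ≡⟨ ℤ.+-identityˡ _ ⟩
  row (insert zero a π) (suc zero) + ∑[ i < suc n ] row (insert zero a π) (suc (suc i))
    ≡⟨ cong₂ _+_ (row-insert-one a π) (sum-cong-≗ {suc n} (row-insert-suc a π)) ⟩
  u + ∑[ i < suc n ] (row π (suc i) - bond π (suc i) a)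
    ≡⟨ +-congˡ u (sum-minus {suc n} (row π ∘ suc) (λ i → bond π (suc i) a)) ⟩
  u + (sum (row π ∘ suc) - ∑[ i < suc n ] bond π (suc i) a)
    ≡⟨ rearrange u (∑[ i < suc n ] row π (suc i)) (∑[ i < suc n ] bond π (suc i) a) ⟩
  bonds π + u - ∑[ i < suc (suc n) ] bond π i a
    ≡⟨ cong (λ c → bonds π + u - c) (sum-bondˡ π a) ⟩
  bonds π + u - column π a ∎
  where
  open ≡-Reasoning
  u = near a (π ⟨$⟩ʳ zero)

  rearrange : ∀ u r b → u + (r - b) ≡ 0ℤ + r + u - (0ℤ + b)
  rearrange = solve-∀

-- The product marks the values a that destroy one bond and create another. The column is expanded
-- into single bonds so that each can be compared with the first digit.
sum-column-near : (π : Permutation′ (suc n)) →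
  ∑[ a < suc (suc n) ] (column π a * near a (π ⟨$⟩ʳ zero)) ≡ row π (suc zero)
sum-column-near {n} π = begin
  ∑[ a < suc (suc n) ] (column π a * u a)
    ≡⟨ sum-cong-≗ {suc (suc n)} (λ a → trans (cong (_* u a) (sym (sum-bondˡ π a)))
         (*-distribʳ-sum {suc (suc n)} (u a) (λ i → bond π i a))) ⟩
  ∑[ a < suc (suc n) ] ∑[ i < suc (suc n) ] (bond π i a * u a)
    ≡⟨ ∑-comm {suc (suc n)} {suc (suc n)} (λ a i → bond π i a * u a) ⟩
  ∑[ i < suc (suc n) ] ∑[ a < suc (suc n) ] (bond π i a * u a)
    -- Gap zero is extreme. A bond at gap one contains the first digit, so `near` is automatic
    -- there; bonds at later gaps avoid the first digit, which then cannot be a - 1 or a.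
    ≡⟨ cong₂ _+_ (sum-zero {suc (suc n)} (λ a → 0ℤ * u a) (λ _ → refl))
         (cong₂ _+_ (trans (sum-cong-≗ {suc (suc n)} first) (sum-bond π (suc zero)))
           (sum-zero {n} (λ i → ∑[ a < suc (suc n) ] (bond π (suc (suc i)) a * u a))
             λ i → sum-zero {suc (suc n)} (λ a → bond π (suc (suc i)) a * u a) (later i))) ⟩
  0ℤ + (row π (suc zero) + 0ℤ)
    ≡⟨ trans (ℤ.+-identityˡ _) (ℤ.+-identityʳ _) ⟩
  row π (suc zero) ∎
  where
  open ≡-Reasoning
  u = λ a → near a (π ⟨$⟩ʳ zero)

  first : ∀ a → bond π (suc zero) a * u a ≡ bond π (suc zero) a
  first a with sides (suc {suc n} zero)
  ... | outer _ = refl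
  ... | inner zero y _ _ = link-near a (π ⟨$⟩ʳ zero) (π ⟨$⟩ʳ y)

  later : ∀ i a → bond π (suc (suc i)) a * u a ≡ 0ℤ
  later i a with sides (suc (suc i))
  ... | outer _ = refl
  ... | inner (suc x) (suc y) _ _ = link-near-≢ a (first-≢ x) (first-≢ y)
    where
    first-≢ : ∀ x → π ⟨$⟩ʳ zero ≢ π ⟨$⟩ʳ suc x
    first-≢ x p with () ← trans (sym (inverseˡ π)) (trans (cong (π ⟨$⟩ˡ_) p) (inverseˡ π {suc x}))

-- Of the n + 2 choices of a, two create a bond, and each old bond is destroyed by exactly one and
-- survives the other n + 1.
sum-bonds-insert : (π : Permutation′ (suc n)) →
  ∑[ a < suc (suc n) ] bonds (insert zero a π) ≡
  + 2 + + suc n * bonds π + 0ℤ + 0ℤ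
sum-bonds-insert {n} π = begin
  ∑[ a < suc (suc n) ] bonds (insert zero a π)
    ≡⟨ sum-cong-≗ {suc (suc n)} (λ a → trans (bonds-insert a π) (linear β (u a) (column π a))) ⟩
  ∑[ a < suc (suc n) ] (β + 1ℤ * u a + (- 1ℤ) * column π a + 0ℤ)
    ≡⟨ sum-linear {suc (suc n)} β 1ℤ (- 1ℤ) 0ℤ u (column π) (λ _ → 0ℤ) ⟩
  + suc (suc n) * β + 1ℤ * sum u + (- 1ℤ) * sum (column π) + 0ℤ
    ≡⟨ cong₂ (λ x y → + suc (suc n) * β + 1ℤ * x + (- 1ℤ) * y + 0ℤ)
         (sum-near (π ⟨$⟩ʳ zero)) (sum-column π) ⟩
  + suc (suc n) * β + 1ℤ * + 2 + (- 1ℤ) * β + 0ℤ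
    ≡⟨ collect (+ suc n) β ⟩
  + 2 + + suc n * β + 0ℤ + 0ℤ ∎
  where
  open ≡-Reasoning
  β = bonds π
  u = λ a → near a (π ⟨$⟩ʳ zero)

  linear : ∀ β u c → β + u - c ≡ β + 1ℤ * u + (- 1ℤ) * c + 0ℤ
  linear = solve-∀
  collect : ∀ n β → (1ℤ + n) * β + 1ℤ * + 2 + (- 1ℤ) * β + 0ℤ ≡ + 2 + n * β + 0ℤ + 0ℤ
  collect = solve-∀

-- In the square of β + u - c the indicators u and c are idempotent, so the only new quantity is the
-- cross term c u, which sums to the entry of `row π` at gap one.
sum-bonds²-insert : (π : Permutation′ (suc n)) →
  ∑[ a < suc (suc n) ] (bonds (insert zero a π) * bonds (insert zero a π)) ≡
  + 2 + + n * (bonds π * bonds π) + + 5 * bonds π + (- + 2) * row π (suc zero)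
sum-bonds²-insert {n} π = begin
  ∑[ a < suc (suc n) ] (bonds (insert zero a π) * bonds (insert zero a π))
    ≡⟨ sum-cong-≗ {suc (suc n)} square ⟩
  ∑[ a < suc (suc n) ] (β * β + (1ℤ + + 2 * β) * u a + (1ℤ - + 2 * β) * column π a + (- + 2) * (column π a * u a))
    ≡⟨ sum-linear {suc (suc n)} (β * β) (1ℤ + + 2 * β) (1ℤ - + 2 * β) (- + 2)
         u (column π) (λ a → column π a * u a) ⟩
  + suc (suc n) * (β * β) + (1ℤ + + 2 * β) * sum u + (1ℤ - + 2 * β) * sum (column π)
    + (- + 2) * ∑[ a < suc (suc n) ] (column π a * u a)
    ≡⟨ cong₂ _+_ (cong₂ (λ x y → + suc (suc n) * (β * β) + (1ℤ + + 2 * β) * x + (1ℤ - + 2 * β) * y)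
                    (sum-near (π ⟨$⟩ʳ zero)) (sum-column π))
         (cong (λ x → (- + 2) * x) (sum-column-near π)) ⟩
  + suc (suc n) * (β * β) + (1ℤ + + 2 * β) * + 2 + (1ℤ - + 2 * β) * β + (- + 2) * row π (suc zero)
    ≡⟨ collect (+ n) β (row π (suc zero)) ⟩
  + 2 + + n * (β * β) + + 5 * β + (- + 2) * row π (suc zero) ∎
  where
  open ≡-Reasoning
  β = bonds π
  u = λ a → near a (π ⟨$⟩ʳ zero)

  expand : ∀ β u c → (β + u - c) * (β + u - c) ≡ β * β + + 2 * β * u - + 2 * β * c + (u * u + c * c) - + 2 * (c * u)
  expand = solve-∀
  regroup : ∀ β u c cu → β * β + + 2 * β * u - + 2 * β * c + (u + c) - + 2 * cu ≡
            β * β + (1ℤ + + 2 * β) * u + (1ℤ - + 2 * β) * c + (- + 2) * cu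
  regroup = solve-∀
  collect : ∀ n β e → (+ 2 + n) * (β * β) + (1ℤ + + 2 * β) * + 2 + (1ℤ - + 2 * β) * β + (- + 2) * e ≡
            + 2 + n * (β * β) + + 5 * β + (- + 2) * e
  collect = solve-∀

  square : ∀ a → bonds (insert zero a π) * bonds (insert zero a π) ≡
           β * β + (1ℤ + + 2 * β) * u a + (1ℤ - + 2 * β) * column π a + (- + 2) * (column π a * u a)
  square a = begin
    bonds (insert zero a π) * bonds (insert zero a π)
      ≡⟨ cong₂ _*_ (bonds-insert a π) (bonds-insert a π) ⟩
    (β + u a - c) * (β + u a - c)
      ≡⟨ expand β (u a) c ⟩
    β * β + + 2 * β * u a - + 2 * β * c + (u a * u a + c * c) - + 2 * (c * u a)
      ≡⟨ cong (λ s → β * β + + 2 * β * u a - + 2 * β * c + s - + 2 * (c * u a))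
           (cong₂ _+_ (⟦⟧-idem (∣ toℕ a - toℕ (punchIn a (π ⟨$⟩ʳ zero)) ∣ ℕ.≟ 1)) (row-idem (flip π) a)) ⟩
    β * β + + 2 * β * u a - + 2 * β * c + (u a + c) - + 2 * (c * u a)
      ≡⟨ regroup β (u a) c (c * u a) ⟩
    _ ∎
    where c = column π a

∑ₚ-by-first : (f : Permutation′ (suc n) → ℤ) → ∑ₚ f ≡ ∑ₚ (λ π → ∑[ a < suc n ] f (insert zero a π))
∑ₚ-by-first {n} f = trans (∑ₚ-insert-zero f) (sym (sumOver-sum (λ π a → f (insert zero a π)) (permutations n)))

∑ₚ-linear : ∀ k p q r (f g h : Permutation′ n → ℤ) →
            ∑ₚ (λ π → k + p * f π + q * g π + r * h π) ≡ + (n !) * k + p * ∑ₚ f + q * ∑ₚ g + r * ∑ₚ h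
∑ₚ-linear {n} k p q r f g h = trans (sumOver-linear k p q r f g h (permutations n))
  (cong (λ l → + l * k + p * ∑ₚ f + q * ∑ₚ g + r * ∑ₚ h) (length-permutations n))

∑ₚ-row-one : ∀ n → ∑ₚ {suc (suc n)} (λ π → row π (suc zero)) ≡ + 2 * + (suc n !)
∑ₚ-row-one n = begin
  ∑ₚ {suc (suc n)} (λ π → row π (suc zero))
    ≡⟨ ∑ₚ-by-first {suc n} (λ π → row π (suc zero)) ⟩
  ∑ₚ {suc n} (λ π → ∑[ a < suc (suc n) ] row (insert zero a π) (suc zero))
    ≡⟨ sumOver-cong (λ π → trans (sum-cong-≗ {suc (suc n)} (λ a → row-insert-one a π)) (sum-near (π ⟨$⟩ʳ zero)))
         (permutations (suc n)) ⟩
  ∑ₚ {suc n} (λ _ → + 2 + 0ℤ + 0ℤ + 0ℤ)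
    ≡⟨ ∑ₚ-linear {suc n} (+ 2) 0ℤ 0ℤ 0ℤ (λ _ → 0ℤ) (λ _ → 0ℤ) (λ _ → 0ℤ) ⟩
  + (suc n !) * + 2 + 0ℤ + 0ℤ + 0ℤ
    ≡⟨ collect (+ (suc n !)) ⟩
  + 2 * + (suc n !) ∎
  where
  open ≡-Reasoning
  collect : ∀ F → F * + 2 + 0ℤ + 0ℤ + 0ℤ ≡ + 2 * F
  collect = solve-∀

+!-suc : ∀ n → + (suc n !) ≡ (1ℤ + + n) * + (n !)
+!-suc n = ℤ.pos-* (suc n) (n !)

-- For positive n the closed form is also the direct count: n gaps, n pairs of consecutive values,
-- two orders, and (n - 1)! arrangements of the rest.
∑ₚ-bonds : ∀ n → ∑ₚ {suc n} bonds ≡ + 2 * + n * + (n !)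
∑ₚ-bonds zero    = refl
∑ₚ-bonds (suc n) = begin
  ∑ₚ {suc (suc n)} bonds
    ≡⟨ ∑ₚ-by-first {suc n} bonds ⟩
  ∑ₚ {suc n} (λ π → ∑[ a < suc (suc n) ] bonds (insert zero a π))
    ≡⟨ sumOver-cong sum-bonds-insert (permutations (suc n)) ⟩
  ∑ₚ {suc n} (λ π → + 2 + + suc n * bonds π + 0ℤ + 0ℤ)
    ≡⟨ ∑ₚ-linear {suc n} (+ 2) (+ suc n) 0ℤ 0ℤ bonds (λ _ → 0ℤ) (λ _ → 0ℤ) ⟩
  + (suc n !) * + 2 + + suc n * ∑ₚ {suc n} bonds + 0ℤ + 0ℤ
    ≡⟨ cong₂ (λ F T → F * + 2 + + suc n * T + 0ℤ + 0ℤ)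
         (+!-suc n) (∑ₚ-bonds n) ⟩
  (1ℤ + + n) * + (n !) * + 2 + + suc n * (+ 2 * + n * + (n !)) + 0ℤ + 0ℤ
    ≡⟨ collect (+ n) (+ (n !)) ⟩
  + 2 * + suc n * ((1ℤ + + n) * + (n !))
    ≡⟨ cong (λ F → + 2 * + suc n * F) (+!-suc n) ⟨
  + 2 * + suc n * + (suc n !) ∎
  where
  open ≡-Reasoning
  collect : ∀ n F → (1ℤ + n) * F * + 2 + (1ℤ + n) * (+ 2 * n * F) + 0ℤ + 0ℤ ≡
            + 2 * (1ℤ + n) * ((1ℤ + n) * F)
  collect = solve-∀

-- The summand 2 (n + 1)² n! is the first moment on n + 2 digits, so 4 n² n! counts ordered pairs of
-- distinct bonds.
∑ₚ-bonds² : ∀ n → ∑ₚ {suc (suc n)} (λ π → bonds π * bonds π) ≡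
            (+ 4 * + n * + n + + 2 * (1ℤ + + n) * (1ℤ + + n)) * + (n !)
∑ₚ-bonds² zero    = refl
∑ₚ-bonds² (suc n) = begin
  ∑ₚ {suc (suc (suc n))} (λ π → bonds π * bonds π)
    ≡⟨ ∑ₚ-by-first {suc (suc n)} (λ π → bonds π * bonds π) ⟩
  ∑ₚ {suc (suc n)} (λ π → ∑[ a < suc (suc (suc n)) ] (bonds (insert zero a π) * bonds (insert zero a π)))
    ≡⟨ sumOver-cong sum-bonds²-insert (permutations (suc (suc n))) ⟩
  ∑ₚ {suc (suc n)} (λ π → + 2 + + suc n * (bonds π * bonds π) + + 5 * bonds π + (- + 2) * row π (suc zero))
    ≡⟨ ∑ₚ-linear {suc (suc n)} (+ 2) (+ suc n) (+ 5) (- + 2)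
         (λ π → bonds π * bonds π) bonds (λ π → row π (suc zero)) ⟩
  + (suc (suc n) !) * + 2 + + suc n * ∑ₚ {suc (suc n)} (λ π → bonds π * bonds π)
    + + 5 * ∑ₚ {suc (suc n)} bonds + (- + 2) * ∑ₚ {suc (suc n)} (λ π → row π (suc zero))
    ≡⟨ cong₂ _+_ (cong₂ _+_ (cong₂ (λ F T → F * + 2 + + suc n * T)
         (trans (+!-suc (suc n)) (cong (λ F → + suc (suc n) * F) (+!-suc n))) (∑ₚ-bonds² n))
         (cong (λ T → + 5 * T) (trans (∑ₚ-bonds (suc n)) (cong (λ F → + 2 * + suc n * F) (+!-suc n)))))
         (cong (λ T → (- + 2) * T) (trans (∑ₚ-row-one n) (cong (λ F → + 2 * F) (+!-suc n)))) ⟩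
  _ ≡⟨ collect (+ n) (+ (n !)) ⟩
  (+ 4 * + suc n * + suc n + + 2 * + suc (suc n) * + suc (suc n)) * ((1ℤ + + n) * + (n !))
    ≡⟨ cong (λ F → (+ 4 * + suc n * + suc n + + 2 * + suc (suc n) * + suc (suc n)) * F) (+!-suc n) ⟨
  (+ 4 * + suc n * + suc n + + 2 * + suc (suc n) * + suc (suc n)) * + (suc n !) ∎
  where
  open ≡-Reasoning
  collect : ∀ n F → (+ 2 + n) * ((1ℤ + n) * F) * + 2
    + (1ℤ + n) * ((+ 4 * n * n + + 2 * (1ℤ + n) * (1ℤ + n)) * F)
    + + 5 * (+ 2 * (1ℤ + n) * ((1ℤ + n) * F)) + (- + 2) * (+ 2 * ((1ℤ + n) * F)) ≡
    (+ 4 * (1ℤ + n) * (1ℤ + n) + + 2 * (+ 2 + n) * (+ 2 + n)) * ((1ℤ + n) * F)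
  collect = solve-∀

-- The expectation

+sum≡sumOver : (X : A → ℕ) (xs : List A) → + ℕsum (map X xs) ≡ sumOver (λ x → + X x) xs
+sum≡sumOver X []       = refl
+sum≡sumOver X (x ∷ xs) = +-congˡ (+ X x) (+sum≡sumOver X xs)

length-filter-tabulate : {P : A → Set} (P? : Decidable P) (g : Fin n → A) →
                         + length (filter P? (tabulate g)) ≡ ∑[ i < n ] ⟦ P? (g i) ⟧
length-filter-tabulate {n = zero}  P? g = refl
length-filter-tabulate {n = suc n} P? g with P? (g zero)
... | yes _ = +-congˡ 1ℤ (length-filter-tabulate P? (g ∘ suc))
... | no  _ = trans (length-filter-tabulate P? (g ∘ suc)) (sym (ℤ.+-identityˡ _))

Separator-cong : {π ρ : Permutation′ n} {i : Fin n} → π ≈ ρ → Separator π i → Separator ρ i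
Separator-cong {π = π} {ρ} π≈ρ (inj₁ v) = inj₁ (VerticalSeparator-cong {π = π} {ρ} π≈ρ v)
Separator-cong {π = π} {ρ} {i} π≈ρ (inj₂ h) = inj₂ (subst (HorizontalSeparator ρ) (π≈ρ i)
  (VerticalSeparator-cong {π = flip π} {flip ρ} (flip-cong {π = π} {ρ} π≈ρ) h))

∑ₚ-#separators : ∀ n → + ℕsum (map #separators (permutations (suc n))) ≡
                 (+ 2 * + n + 1ℤ) * ∑ₚ {n} bonds - ∑ₚ {n} (λ π → bonds π * bonds π)
∑ₚ-#separators n = begin
  + ℕsum (map #separators (permutations (suc n)))
    ≡⟨ +sum≡sumOver #separators (permutations (suc n)) ⟩
  ∑ₚ {suc n} (λ π → + #separators π)
    ≡⟨ sumOver-cong (λ π → length-filter-tabulate (separator? π) (λ i → i)) (permutations (suc n)) ⟩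
  ∑ₚ {suc n} (λ π → ∑[ i < suc n ] ⟦ separator? π i ⟧)
    ≡⟨ sumOver-sum (λ π i → ⟦ separator? π i ⟧) (permutations (suc n)) ⟩
  ∑[ i < suc n ] ∑ₚ {suc n} (λ π → ⟦ separator? π i ⟧)
    -- Each summand has its own insertion position: the digit tested for being a separator is the
    -- inserted one.
    ≡⟨ sum-cong-≗ {suc n} (λ i → ∑ₚ-insert i (λ π → ⟦ separator? π i ⟧)
         (λ {π} {ρ} π≈ρ → ⟦⟧-cong (separator? π i) (separator? ρ i)
            (Separator-cong {π = π} {ρ} π≈ρ) (Separator-cong {π = ρ} {π} (sym ∘ π≈ρ)))) ⟩
  ∑[ i < suc n ] ∑[ a < suc n ] ∑ₚ {n} (λ π → ⟦ separator? (insert i a π) i ⟧)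
    ≡⟨ sum-cong-≗ {suc n} (λ i → sym (sumOver-sum (λ π a → ⟦ separator? (insert i a π) i ⟧) (permutations n))) ⟩
  ∑[ i < suc n ] ∑ₚ {n} (λ π → ∑[ a < suc n ] ⟦ separator? (insert i a π) i ⟧)
    ≡⟨ sumOver-sum (λ π i → ∑[ a < suc n ] ⟦ separator? (insert i a π) i ⟧) (permutations n) ⟨
  ∑ₚ {n} (λ π → ∑[ i < suc n ] ∑[ a < suc n ] ⟦ separator? (insert i a π) i ⟧)
    ≡⟨ sumOver-cong sum-Separator-insert (permutations n) ⟩
  ∑ₚ {n} (λ π → 0ℤ + (+ 2 * + n + 1ℤ) * bonds π + (- 1ℤ) * (bonds π * bonds π) + 0ℤ)
    ≡⟨ ∑ₚ-linear {n} 0ℤ (+ 2 * + n + 1ℤ) (- 1ℤ) 0ℤ bonds (λ π → bonds π * bonds π) (λ _ → 0ℤ) ⟩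
  + (n !) * 0ℤ + (+ 2 * + n + 1ℤ) * ∑ₚ {n} bonds + (- 1ℤ) * ∑ₚ {n} (λ π → bonds π * bonds π) + 0ℤ
    ≡⟨ collect (+ (n !)) ((+ 2 * + n + 1ℤ) * ∑ₚ {n} bonds) _ ⟩
  (+ 2 * + n + 1ℤ) * ∑ₚ {n} bonds - ∑ₚ {n} (λ π → bonds π * bonds π) ∎
  where
  open ≡-Reasoning
  collect : ∀ F x y → F * 0ℤ + x + (- 1ℤ) * y + 0ℤ ≡ x - y
  collect = solve-∀

-- The two arguments differ: n is the size of the permutations in the numerator, and
-- 3 less than it in the denominator.

numerator : ℤ → ℤ
numerator n = + 4 * (n ^ 3 - + 6 * n ^ 2 + + 14 * n - + 13)

denominator : ℕ → ℕ
denominator n = (3 ℕ.+ n) ℕ.* (2 ℕ.+ n) ℕ.* (1 ℕ.+ n)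

∑ₚ-#separators-closed : ∀ n → + ℕsum (map #separators (permutations (3 ℕ.+ n))) ≡
                        numerator (+ 3 + + n) * + (n !)
∑ₚ-#separators-closed n = begin
  + ℕsum (map #separators (permutations (3 ℕ.+ n)))
    ≡⟨ ∑ₚ-#separators (2 ℕ.+ n) ⟩
  (+ 2 * + (2 ℕ.+ n) + 1ℤ) * ∑ₚ {2 ℕ.+ n} bonds - ∑ₚ {2 ℕ.+ n} (λ π → bonds π * bonds π)
    ≡⟨ cong₂ (λ x y → (+ 2 * + (2 ℕ.+ n) + 1ℤ) * x - y)
         (trans (∑ₚ-bonds (suc n)) (cong (λ F → + 2 * + suc n * F) (+!-suc n))) (∑ₚ-bonds² n) ⟩
  _ ≡⟨ collect (+ n) (+ (n !)) ⟩
  numerator (+ 3 + + n) * + (n !) ∎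
  where
  open ≡-Reasoning
  collect : ∀ n F → (+ 2 * (+ 2 + n) + 1ℤ) * (+ 2 * (1ℤ + n) * ((1ℤ + n) * F)) -
            (+ 4 * n * n + + 2 * (1ℤ + n) * (1ℤ + n)) * F ≡
            -- This is `numerator (+ 3 + n)` with the powers unfolded to the products they compute
            -- to.
            + 4 * ((+ 3 + n) * ((+ 3 + n) * ((+ 3 + n) * 1ℤ)) - + 6 * ((+ 3 + n) * ((+ 3 + n) * 1ℤ))
                   + + 14 * (+ 3 + n) - + 13) * F
  collect = solve-∀

/-≡ : ∀ p₁ q₁ p₂ q₂ .{{_ : ℕ.NonZero q₁}} .{{_ : ℕ.NonZero q₂}} →
      p₁ * + q₂ ≡ p₂ * + q₁ → p₁ / q₁ ≡ p₂ / q₂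
/-≡ p₁ (suc q₁) p₂ (suc q₂) eq = ℚ.fromℚᵘ-cong {mkℚᵘ p₁ q₁} {mkℚᵘ p₂ q₂} (*≡* eq)

expectation-#separators : ∀ n → expectation (3 ℕ.+ n) #separators ≡
                          numerator (+ 3 + + n) / denominator n
expectation-#separators n =
  /-≡ (+ ℕsum (map #separators (permutations (3 ℕ.+ n)))) ((3 ℕ.+ n) !) N D {{(3 ℕ.+ n) ℕ.!≢0}} (begin
  + ℕsum (map #separators (permutations (3 ℕ.+ n))) * + D
    ≡⟨ cong (_* + D) (∑ₚ-#separators-closed n) ⟩
  N * + (n !) * + D
    ≡⟨ ℤ.*-assoc N (+ (n !)) (+ D) ⟩
  N * (+ (n !) * + D)
    ≡⟨ cong (λ z → N * z) (ℤ.pos-* (n !) D) ⟨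
  N * + (n ! ℕ.* D)
    ≡⟨ cong (λ z → N * + z) (factorial n (n !)) ⟩
  N * + ((3 ℕ.+ n) !) ∎)
  where
  open ≡-Reasoning
  N = numerator (+ 3 + + n)
  D = denominator n

  factorial : ∀ n F → F ℕ.* ((3 ℕ.+ n) ℕ.* (2 ℕ.+ n) ℕ.* (1 ℕ.+ n)) ≡
              (3 ℕ.+ n) ℕ.* ((2 ℕ.+ n) ℕ.* ((1 ℕ.+ n) ℕ.* F))
  factorial = ℕSolver.solve-∀

-- Convergence to 4

∣p/q-4∣ : ∀ p q c .{{_ : ℕ.NonZero q}} → p - + 4 * + q ≡ - + c → ℚ.∣ p / q ℚ.- + 4 / 1 ∣ ≡ + c / q
-- In `ℚ` the numerator of a quotient is hidden behind the reduction to lowest terms; unnormalised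
-- rationals keep it visible.
∣p/q-4∣ p q@(suc q-1) c eq = ℚ.toℚᵘ-injective (begin
  toℚᵘ ℚ.∣ p / q ℚ.- + 4 / 1 ∣
    ≈⟨ ℚ.toℚᵘ-homo-∣-∣ (p / q ℚ.- + 4 / 1) ⟩
  ℚᵘ.∣ toℚᵘ (p / q ℚ.- + 4 / 1) ∣
    ≈⟨ ℚᵘ.∣-∣-cong (ℚᵘ.≃-trans (ℚ.toℚᵘ-homo-+ (p / q) (ℚ.- (+ 4 / 1)))
         (ℚᵘ.+-congˡ (toℚᵘ (ℚ.- (+ 4 / 1))) (ℚ.toℚᵘ-fromℚᵘ (mkℚᵘ p q-1)))) ⟩
  ℚᵘ.∣ mkℚᵘ p q-1 ℚᵘ.- mkℚᵘ (+ 4) 0 ∣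
    ≈⟨ ℚᵘ.∣-∣-cong {mkℚᵘ p q-1 ℚᵘ.- mkℚᵘ (+ 4) 0} {mkℚᵘ (- + c) q-1} (*≡* numerators) ⟩
  ℚᵘ.∣ mkℚᵘ (- + c) q-1 ∣
    ≡⟨ cong (λ z → mkℚᵘ (+ z) q-1) (ℤ.∣-i∣≡∣i∣ (+ c)) ⟩
  mkℚᵘ (+ c) q-1
    ≈⟨ ℚ.toℚᵘ-fromℚᵘ (mkℚᵘ (+ c) q-1) ⟨
  toℚᵘ (+ c / q) ∎)
  where
  open import Relation.Binary.Reasoning.Setoid ℚᵘ.≃-setoid

  collect : ∀ p q → (p * 1ℤ + (- + 4) * q) * q ≡ (p - + 4 * q) * (q * 1ℤ)
  collect = solve-∀

  numerators : (p * 1ℤ + (- + 4) * + q) * + q ≡ - + c * + (q ℕ.* 1)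
  numerators = trans (collect p (+ q)) (cong₂ _*_ eq (sym (ℤ.pos-* q 1)))

-- A positive rational is at least the reciprocal of its denominator, so it suffices to be below
-- that reciprocal.
c/q<ε : ∀ c q ε .{{_ : ℕ.NonZero q}} → 0ℚ ℚ.< ε → c ℕ.* ℚ.denominatorℕ ε < q → + c / q ℚ.< ε
c/q<ε c q@(suc q-1) (mkℚ +[1+ p ] d-1 _) _ cd<q =
  ℚ.toℚᵘ-cancel-< (ℚᵘ.<-respˡ-≃ (ℚᵘ.≃-sym (ℚ.toℚᵘ-fromℚᵘ (mkℚᵘ (+ c) q-1)))
    (*<* (subst₂ ℤ._<_ (ℤ.pos-* c (suc d-1)) (ℤ.pos-* (suc p) q)
      (ℤ.+<+ (ℕ.<-≤-trans cd<q (ℕ.m≤m+n q (p ℕ.* q)))))))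
c/q<ε c q (mkℚ +0 _ _)       (ℚ.*<* (ℤ.+<+ ())) _
c/q<ε c q (mkℚ -[1+ _ ] _ _) (ℚ.*<* ()) _

-- 4 − expectation (3 + n) #separators = excess n / denominator n, which is at most
-- 12 / (1 + n).

excess : ℕ → ℕ
excess n = 4 ℕ.* (3 ℕ.* n ℕ.* n ℕ.+ 6 ℕ.* n ℕ.+ 4)

numerator-4*denominator : ∀ n → numerator (+ 3 + + n) - + 4 * + denominator n ≡ - + excess n
numerator-4*denominator n = begin
  numerator (+ 3 + + n) - + 4 * + denominator n
    ≡⟨ cong (λ d → numerator (+ 3 + + n) - + 4 * d)
         (trans (ℤ.pos-* ((3 ℕ.+ n) ℕ.* (2 ℕ.+ n)) (1 ℕ.+ n)) (cong (_* + suc n) (ℤ.pos-* (3 ℕ.+ n) (2 ℕ.+ n)))) ⟩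
  numerator (+ 3 + + n) - + 4 * ((+ 3 + + n) * (+ 2 + + n) * (1ℤ + + n))
    ≡⟨ collect (+ n) ⟩
  - (+ 4 * (+ 3 * + n * + n + + 6 * + n + + 4))
    ≡⟨ cong -_ (trans (ℤ.pos-* 4 (3 ℕ.* n ℕ.* n ℕ.+ 6 ℕ.* n ℕ.+ 4)) (cong (λ e → + 4 * (e + + 4))
         (cong₂ _+_ (trans (ℤ.pos-* (3 ℕ.* n) n) (cong (_* + n) (ℤ.pos-* 3 n))) (ℤ.pos-* 6 n)))) ⟨
  - + excess n ∎
  where
  open ≡-Reasoning
  collect : ∀ n →
    + 4 * ((+ 3 + n) * ((+ 3 + n) * ((+ 3 + n) * 1ℤ)) - + 6 * ((+ 3 + n) * ((+ 3 + n) * 1ℤ))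
           + + 14 * (+ 3 + n) - + 13) - + 4 * ((+ 3 + n) * (+ 2 + n) * (1ℤ + n)) ≡ - (+ 4 * (+ 3 * n * n + + 6 * n + + 4))
  collect = solve-∀

excess<denominator : ∀ n d → 12 ℕ.* d ≤ n → excess n ℕ.* d < denominator n
excess<denominator n d 12d≤n = begin-strict
  excess n ℕ.* d
    -- The added 36 n + 56 is the difference between 12 (3 + n) (2 + n) and `excess n`; completing
    -- the product lets the factor 12 d be compared with 1 + n.
    ≤⟨ ℕ.m≤m+n _ ((36 ℕ.* n ℕ.+ 56) ℕ.* d) ⟩
  excess n ℕ.* d ℕ.+ (36 ℕ.* n ℕ.+ 56) ℕ.* d
    ≡⟨ collect n d ⟩
  (3 ℕ.+ n) ℕ.* (2 ℕ.+ n) ℕ.* (12 ℕ.* d)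
    <⟨ ℕ.*-monoʳ-< ((3 ℕ.+ n) ℕ.* (2 ℕ.+ n)) (s≤s 12d≤n) ⟩
  denominator n ∎
  where
  open ℕ.≤-Reasoning
  collect : ∀ n d → 4 ℕ.* (3 ℕ.* n ℕ.* n ℕ.+ 6 ℕ.* n ℕ.+ 4) ℕ.* d ℕ.+ (36 ℕ.* n ℕ.+ 56) ℕ.* d ≡
                    (3 ℕ.+ n) ℕ.* (2 ℕ.+ n) ℕ.* (12 ℕ.* d)
  collect = ℕSolver.solve-∀

expectation-#separators-limit : TendsTo (λ n → expectation n #separators) (+ 4 / 1)
-- The 3 is the shift of the closed form, and from 12 d on the bound 12 / (1 + n) lies below 1 / d.
expectation-#separators-limit ε 0<ε = 3 ℕ.+ 12 ℕ.* d , bound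
  where
  d = ℚ.denominatorℕ ε

  bound : ∀ n → 3 ℕ.+ 12 ℕ.* d ≤ n → ℚ.∣ expectation n #separators ℚ.- + 4 / 1 ∣ ℚ.< ε
  bound (suc (suc (suc n))) (s≤s (s≤s (s≤s 12d≤n))) = subst (ℚ._< ε)
    (sym (trans (cong (λ e → ℚ.∣ e ℚ.- + 4 / 1 ∣) (expectation-#separators n))
      (∣p/q-4∣ (numerator (+ 3 + + n)) (denominator n) (excess n) (numerator-4*denominator n))))
    (c/q<ε (excess n) (denominator n) ε 0<ε (excess<denominator n d 12d≤n))

theorem4p3 : (∀ n (n≥3 : 3 ≤ n) →
    expectation n #separators ≡
    _/_ (+ 4 * ((+ n) ^ 3 - + 6 * (+ n) ^ 2 + + 14 * + n - + 13))
    (n ℕ.* (n ∸ 1) ℕ.* (n ∸ 2)) {{n[n-1][n-2]≢0 n≥3}})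
    × TendsTo (λ n → expectation n #separators) (+ 4 / 1)
theorem4p3 =
  (λ { (suc (suc (suc n))) (s≤s (s≤s (s≤s _))) → expectation-#separators n })
  , expectation-#separators-limit
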